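{- Let $\mathbf{Ax}$ be the set of axiom schemas consisting of $\alpha\to\neg\neg\alpha$; $\neg(\alpha\vee\beta)\leftrightarrow(\neg\alpha\wedge\neg\beta)$; $\neg(\alpha\wedge\beta)\leftrightarrow(\neg\alpha\vee\neg\beta)$; $\neg(\alpha\to\beta)\leftrightarrow(\alpha\wedge\neg\beta)$. Then $$\mathbb{K}_{\mathbf{LFI1}_\circ}=\{\mathcal{B}\in\mathbb{K}_{\mathbf{Ci}}:\mathcal{M}(\mathcal{B})\text{ validates all the axioms in }\mathbf{Ax}\}.$$
   Context: Let $\Sigma=\{\wedge,\vee,\to,\neg,\circ\}$ ($\neg,\circ$ unary, the others binary); $For(\Sigma)$ is the set of formulas over $\Sigma$ generated by a denumerable set of propositional variables, and $\alpha\leftrightarrow\beta$ abbreviates $(\alpha\to\beta)\wedge(\beta\to\alpha)$. A multialgebra over $\Sigma$ is a nonempty set with operations whose values are nonempty subsets. Elements of swap structures are here pairs. For a Boolean algebra $\mathcal{A}$ with domain $A$ (the one-element Boolean algebra is allowed), complement $\sim$, a swap structure for $\mathbf{Ci}$ over $\mathcal{A}$ is a multialgebra $\mathcal{B}$ over $\Sigma$ with domain $|\mathcal{B}|=B\subseteq\{(z_1,z_2)\in A^2:z_1\vee z_2=1\}$ such that $0\in\{z_1:z\in B\}$ and for all $z,w\in B$: $\emptyset\ne z\#w\subseteq\{u\in B:u_1=z_1\#w_1\}$ for $\#\in\{\wedge,\vee,\to\}$; $\emptyset\ne\neg z\subseteq\{u\in B:u_1=z_2\text{ and }u_2\le z_1\}$;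 $\circ z=\{({\sim}(z_1\wedge z_2),z_1\wedge z_2)\}$. $\mathbb{K}_{\mathbf{Ci}}$ is the class of all of these over arbitrary Boolean algebras. $\mathbb{K}_{\mathbf{LFI1}_\circ}$ is the class of those $\mathcal{B}\in\mathbb{K}_{\mathbf{Ci}}$ whose multioperations are single-valued and given by $z\wedge w=\{(z_1\wedge w_1,z_2\vee w_2)\}$, $z\vee w=\{(z_1\vee w_1,z_2\wedge w_2)\}$, $z\to w=\{(z_1\to w_1,z_1\wedge w_2)\}$, $\neg z=\{(z_2,z_1)\}$, $\circ z=\{({\sim}(z_1\wedge z_2),z_1\wedge z_2)\}$ for all $z,w\in B$. $\mathcal{M}(\mathcal{B})=(\mathcal{B},D_{\mathcal{B}})$ is the Nmatrix with designated set $D_{\mathcal{B}}=\{z\in B:z_1=1\}$. A valuation over $\mathcal{M}(\mathcal{B})$ is $v:For(\Sigma)\to B$ with $v(\alpha\#\beta)\in v(\alpha)\#v(\beta)$, $v(\neg\alpha)\in\neg v(\alpha)$, $v(\circ\alpha)\in\circ v(\alpha)$. $\mathcal{M}(\mathcal{B})$ validates an axiom schema if $v(\gamma)\in D_{\mathcal{B}}$ for every instance $\gamma$ and every valuation $v$. -}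

module Defs where

open import Data.List using (List; []; _∷_)
open import Data.Nat using (ℕ)
open import Data.Product using (Σ; ∃; ∃₂; _×_; _,_; proj₁; proj₂)
open import Data.Product.Relation.Binary.Pointwise.NonDependent using (_×ₛ_)
open import Level using (Level; _⊔_; suc; 0ℓ)
open import Relation.Binary.Bundles using (Setoid)
open import Relation.Binary.Definitions using (_Respects_)
open import Relation.Binary.Lattice.Bundles using (BooleanAlgebra)
import Relation.Binary.Construct.On as On
open import Relation.Binary.PropositionalEquality using (_≡_)
open import Relation.Unary using (Pred; _∈_; _⊆_; Satisfiable)

private variable
  c ℓ₁ ℓ₂ b m d : Level

data Unary : Set where
  neg circ : Unary

data Binary : Set where
  and or imp : Binary

data For : Set where
  var : ℕ → For
  un  : Unary → For → For
  bin : Binary → For → For → For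

infix  9 ¬ᶠ_ ∘ᶠ_
infixr 7 _∧ᶠ_
infixr 6 _∨ᶠ_
infixr 5 _→ᶠ_
infix  4 _↔ᶠ_

pattern ¬ᶠ_ α = un neg α
pattern ∘ᶠ_ α = un circ α
pattern _∧ᶠ_ α β = bin and α β
pattern _∨ᶠ_ α β = bin or α β
pattern _→ᶠ_ α β = bin imp α β

_↔ᶠ_ : For → For → For
α ↔ᶠ β = (α →ᶠ β) ∧ᶠ (β →ᶠ α)

-- A schema in (at most) the two schematic letters α and β.
Schema : Set
Schema = For → For → For

_InstanceOf_ : For → Schema → Set
γ InstanceOf S = ∃₂ λ α β → γ ≡ S α β

Ax : List Schema
Ax = (λ α β → α →ᶠ ¬ᶠ ¬ᶠ α)
   ∷ (λ α β → ¬ᶠ (α ∨ᶠ β) ↔ᶠ (¬ᶠ α ∧ᶠ ¬ᶠ β))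
   ∷ (λ α β → ¬ᶠ (α ∧ᶠ β) ↔ᶠ (¬ᶠ α ∨ᶠ ¬ᶠ β))
   ∷ (λ α β → ¬ᶠ (α →ᶠ β) ↔ᶠ (α ∧ᶠ ¬ᶠ β))
   ∷ []

-- `Satisfiable P` is ∃ x, x ∈ P: values are nonempty in the constructive
-- sense.  The domain is a setoid, so multioperations must be compatible with its
-- equality, both in their arguments and in their values.
record Multialgebra (S : Setoid c ℓ₁) m : Set (c ⊔ ℓ₁ ⊔ suc m) where
  open Setoid S
  field
    element   : Carrier
    unᴹ       : Unary → Carrier → Pred Carrier m
    binᴹ      : Binary → Carrier → Carrier → Pred Carrier m
    un-nonempty  : ∀ o z → Satisfiable (unᴹ o z)
    bin-nonempty : ∀ o z w → Satisfiable (binᴹ o z w)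
    un-cong   : ∀ o {z z′ u u′} → z ≈ z′ → u ≈ u′ →
                u ∈ unᴹ o z → u′ ∈ unᴹ o z′
    bin-cong  : ∀ o {z z′ w w′ u u′} → z ≈ z′ → w ≈ w′ → u ≈ u′ →
                u ∈ binᴹ o z w → u′ ∈ binᴹ o z′ w′

record Nmatrix c ℓ m d : Set (suc (c ⊔ ℓ ⊔ m ⊔ d)) where
  field
    domain       : Setoid c ℓ
    multialgebra : Multialgebra domain m
  open Setoid domain public
  open Multialgebra multialgebra public
  field
    Designated      : Pred Carrier d
    Designated-resp : Designated Respects _≈_

module _ (M : Nmatrix c ℓ₁ m d) where
  open Nmatrix M

  IsValuation : (For → Carrier) → Set m
  IsValuation v =
    (∀ o α → v (un o α) ∈ unᴹ o (v α)) ×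
    (∀ o α β → v (bin o α β) ∈ binᴹ o (v α) (v β))

  Validates : Schema → Set (c ⊔ m ⊔ d)
  Validates S = ∀ γ → γ InstanceOf S →
                ∀ v → IsValuation v → v γ ∈ Designated

module _ (𝒜 : BooleanAlgebra c ℓ₁ ℓ₂) where
  open BooleanAlgebra 𝒜 renaming (¬_ to ∼_)

  pairs : Setoid c ℓ₁
  pairs = setoid ×ₛ setoid

  open Setoid pairs public using () renaming (Carrier to Pair; _≈_ to _≋_)

  -- Equality of elements of B ignores the proofs of membership in B.
  subsetoid : Pred Pair b → Setoid (c ⊔ b) ℓ₁
  subsetoid B = On.setoid pairs (proj₁ {B = B})

  -- P, a set of elements of B ⊆ A², is the singleton {a}.
  Is｛_｝ : {B : Pred Pair b} → Pair → Pred (Σ Pair B) m → Set (c ⊔ ℓ₁ ⊔ b ⊔ m)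
  Is｛ a ｝ P = (∃ λ u → u ∈ P × proj₁ u ≋ a) ×
               (∀ u → u ∈ P → proj₁ u ≋ a)

  -- By definition, x ⇨ y is ∼ x ∨ y.
  ⟦_⟧ : Binary → Carrier → Carrier → Carrier
  ⟦ and ⟧ = _∧_
  ⟦ or  ⟧ = _∨_
  ⟦ imp ⟧ = _⇨_

  circᶜ : Pair → Pair
  circᶜ (z₁ , z₂) = ∼ (z₁ ∧ z₂) , z₁ ∧ z₂

  record Swap-Ci b m : Set (c ⊔ ℓ₁ ⊔ ℓ₂ ⊔ suc (b ⊔ m)) where
    field
      B            : Pred Pair b
      B-resp       : B Respects _≋_
      multialgebra : Multialgebra (subsetoid B) m
    open Multialgebra multialgebra public

    El : Set (c ⊔ b)
    El = Σ Pair B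

    fst : El → Carrier
    fst z = proj₁ (proj₁ z)

    snd : El → Carrier
    snd z = proj₂ (proj₁ z)

    field
      B-total : ∀ z → fst z ∨ snd z ≈ ⊤
      B-zero  : ∃ λ z → fst z ≈ ⊥
      bin-sub : ∀ o z w → binᴹ o z w ⊆ λ u → fst u ≈ ⟦ o ⟧ (fst z) (fst w)
      neg-sub : ∀ z → unᴹ neg z ⊆ λ u → (fst u ≈ snd z) × (snd u ≤ fst z)
      circ-eq : ∀ z → Is｛ circᶜ (proj₁ z) ｝ (unᴹ circ z)

  binᴸ : Binary → Pair → Pair → Pair
  binᴸ and (z₁ , z₂) (w₁ , w₂) = z₁ ∧ w₁ , z₂ ∨ w₂
  binᴸ or  (z₁ , z₂) (w₁ , w₂) = z₁ ∨ w₁ , z₂ ∧ w₂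
  binᴸ imp (z₁ , z₂) (w₁ , w₂) = z₁ ⇨ w₁ , z₁ ∧ w₂

  unᴸ : Unary → Pair → Pair
  unᴸ neg  (z₁ , z₂) = z₂ , z₁
  unᴸ circ z         = circᶜ z

𝕂-Ci : ∀ c ℓ₁ ℓ₂ b m → Set (suc (c ⊔ ℓ₁ ⊔ ℓ₂ ⊔ b ⊔ m))
𝕂-Ci c ℓ₁ ℓ₂ b m = Σ (BooleanAlgebra c ℓ₁ ℓ₂) λ 𝒜 → Swap-Ci 𝒜 b m

𝕂-LFI1∘ : Pred (𝕂-Ci c ℓ₁ ℓ₂ b m) (c ⊔ ℓ₁ ⊔ b ⊔ m)
𝕂-LFI1∘ (𝒜 , ℬ) =
  (∀ o z → Is｛_｝ 𝒜 (unᴸ 𝒜 o (proj₁ z)) (unᴹ o z)) ×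
  (∀ o z w → Is｛_｝ 𝒜 (binᴸ 𝒜 o (proj₁ z) (proj₁ w)) (binᴹ o z w))
  where open Swap-Ci ℬ

ℳ : 𝕂-Ci c ℓ₁ ℓ₂ b m → Nmatrix (c ⊔ b) ℓ₁ m ℓ₁
ℳ (𝒜 , ℬ) = record
  { domain          = subsetoid 𝒜 B
  ; multialgebra    = multialgebra
  ; Designated      = λ z → fst z ≈ ⊤
  ; Designated-resp = λ { (z₁≈w₁ , _) z₁≈⊤ → Eq.trans (Eq.sym z₁≈w₁) z₁≈⊤ }
  }
  where
  open BooleanAlgebra 𝒜 using (_≈_; ⊤; module Eq)
  open Swap-Ci ℬ

{-# OPTIONS --safe #-}

-- For every valuation v over ℳ(ℬ), v(¬α)₁ = v(α)₂, so an instance of an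
-- axiom of Ax is designated iff one (in)equality between coordinates holds:
-- v(α)₁ ≤ v(¬α)₂ for the first axiom and, for the other three, that v(α # β)₂
-- is the second coordinate prescribed by LFI1∘.
-- Conversely, any u ∈ z # w (or u ∈ ¬z) is the value of p # q (or ¬p) under
-- some valuation, so these conditions pass from valuations to elements.
module Submission where

open import Defs
open import Data.List.Relation.Unary.All using (All; []; _∷_)
open import Data.Nat using (zero; suc)
open import Data.Product using (_×_; _,_; proj₁; proj₂)
open import Function.Bundles using (_⇔_; mk⇔; module Equivalence)
open import Level using (Level; _⊔_)
open import Relation.Binary.Lattice.Bundles using (BooleanAlgebra)
open import Relation.Binary.PropositionalEquality using (refl)
open import Relation.Unary using (_≐_; _∈_; Pred; Satisfiable)
import Relation.Binary.Lattice.Properties.HeytingAlgebra as HeytingProperties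
import Relation.Binary.Lattice.Properties.JoinSemilattice as JoinProperties
import Relation.Binary.Lattice.Properties.MeetSemilattice as MeetProperties

module _ {c ℓ₁ ℓ₂} (𝒜 : BooleanAlgebra c ℓ₁ ℓ₂) where
  open BooleanAlgebra 𝒜 renaming (refl to ≤-refl)
  open HeytingProperties heytingAlgebra using (⇨-applyˡ)

  ⇨≈⊤⇔≤ : ∀ {x y} → x ⇨ y ≈ ⊤ ⇔ x ≤ y
  ⇨≈⊤⇔≤ {x} {y} = mk⇔
    (λ x⇨y≈⊤ → trans (∧-greatest (trans (maximum x) (reflexive (Eq.sym x⇨y≈⊤))) ≤-refl)
                     (⇨-applyˡ ≤-refl))
    (λ x≤y → antisym (maximum _) (transpose-⇨ (trans (x∧y≤y _ _) x≤y)))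

  ∧≈⊤⇔ : ∀ {x y} → x ∧ y ≈ ⊤ ⇔ (x ≈ ⊤ × y ≈ ⊤)
  ∧≈⊤⇔ {x} {y} = mk⇔
    (λ x∧y≈⊤ → antisym (maximum x) (trans (reflexive (Eq.sym x∧y≈⊤)) (x∧y≤x x y))
             , antisym (maximum y) (trans (reflexive (Eq.sym x∧y≈⊤)) (x∧y≤y x y)))
    (λ { (x≈⊤ , y≈⊤) → antisym (maximum _)
           (∧-greatest (reflexive (Eq.sym x≈⊤)) (reflexive (Eq.sym y≈⊤))) })

-- The right-hand sides of the three biconditionals in `Ax`, indexed by the connective under the
-- negation so that one argument covers all three.
deMorgan : Binary → Schema
deMorgan and α β = ¬ᶠ α ∨ᶠ ¬ᶠ β
deMorgan or  α β = ¬ᶠ α ∧ᶠ ¬ᶠ β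
deMorgan imp α β = α ∧ᶠ ¬ᶠ β

¬¬-schema : Schema
¬¬-schema α β = α →ᶠ ¬ᶠ ¬ᶠ α

deMorgan-schema : Binary → Schema
deMorgan-schema o α β = ¬ᶠ (bin o α β) ↔ᶠ deMorgan o α β

module _ {c ℓ₁ ℓ₂ b m} (𝒜 : BooleanAlgebra c ℓ₁ ℓ₂) (ℬ : Swap-Ci 𝒜 b m) where
  open BooleanAlgebra 𝒜 hiding (refl)
  open JoinProperties joinSemilattice using (∨-cong)
  open MeetProperties meetSemilattice using (∧-cong)
  open Swap-Ci ℬ

  binᴸ₂ : Binary → El → El → Carrier
  binᴸ₂ o z w = proj₂ (binᴸ 𝒜 o (proj₁ z) (proj₁ w))

  M : Nmatrix (c ⊔ b) ℓ₁ m ℓ₁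
  M = ℳ (𝒜 , ℬ)

  module _ {v : For → El} (valid : IsValuation M v) where

    fst-bin : ∀ o α β → fst (v (bin o α β)) ≈ ⟦_⟧ 𝒜 o (fst (v α)) (fst (v β))
    fst-bin o α β = bin-sub o (v α) (v β) (proj₂ valid o α β)

    fst-neg : ∀ α → fst (v (¬ᶠ α)) ≈ snd (v α)
    fst-neg α = proj₁ (neg-sub (v α) (proj₁ valid neg α))

    -- The second coordinate prescribed by `binᴸ` is the Boolean reading of `deMorgan o α β`, with
    -- each negated subformula read through `fst-neg` as a second coordinate.
    fst-deMorgan : ∀ o α β → fst (v (deMorgan o α β)) ≈ binᴸ₂ o (v α) (v β)
    fst-deMorgan and α β = Eq.trans (fst-bin or _ _) (∨-cong (fst-neg α) (fst-neg β))
    fst-deMorgan or  α β = Eq.trans (fst-bin and _ _) (∧-cong (fst-neg α) (fst-neg β))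
    fst-deMorgan imp α β = Eq.trans (fst-bin and _ _) (∧-cong Eq.refl (fst-neg β))

    →ᶠ-designated⇔ : ∀ α β → fst (v (α →ᶠ β)) ≈ ⊤ ⇔ fst (v α) ≤ fst (v β)
    →ᶠ-designated⇔ α β = mk⇔
      (λ d → to (Eq.trans (Eq.sym (fst-bin imp α β)) d))
      (λ α≤β → Eq.trans (fst-bin imp α β) (from α≤β))
      where open Equivalence (⇨≈⊤⇔≤ 𝒜)

    ↔ᶠ-designated⇔ : ∀ α β → fst (v (α ↔ᶠ β)) ≈ ⊤ ⇔ fst (v α) ≈ fst (v β)
    ↔ᶠ-designated⇔ α β = mk⇔
      (λ d → let (d₁ , d₂) = Top.to (Eq.trans (Eq.sym (fst-bin and _ _)) d) in
             antisym (L.to d₁) (R.to d₂))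
      (λ α≈β → Eq.trans (fst-bin and _ _)
                 (Top.from (L.from (reflexive α≈β) , R.from (reflexive (Eq.sym α≈β)))))
      where
      module Top = Equivalence (∧≈⊤⇔ 𝒜)
      module L = Equivalence (→ᶠ-designated⇔ α β)
      module R = Equivalence (→ᶠ-designated⇔ β α)

    -- By `fst-neg` at `¬ᶠ α`, the first coordinate of the double negation is the second coordinate
    -- of the single one.
    ¬¬-designated⇔ : ∀ α β → fst (v (¬¬-schema α β)) ≈ ⊤ ⇔ fst (v α) ≤ snd (v (¬ᶠ α))
    ¬¬-designated⇔ α β = mk⇔
      (λ d → trans (to d) (reflexive (fst-neg (¬ᶠ α))))
      (λ α≤¬α → from (trans α≤¬α (reflexive (Eq.sym (fst-neg (¬ᶠ α))))))
      where open Equivalence (→ᶠ-designated⇔ α (¬ᶠ ¬ᶠ α))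

    deMorgan-designated⇔ : ∀ o α β → fst (v (deMorgan-schema o α β)) ≈ ⊤ ⇔
                           snd (v (bin o α β)) ≈ binᴸ₂ o (v α) (v β)
    deMorgan-designated⇔ o α β = mk⇔
      (λ d → Eq.trans (Eq.sym (fst-neg (bin o α β)))
                      (Eq.trans (to d) (fst-deMorgan o α β)))
      (λ eq → from (Eq.trans (fst-neg (bin o α β))
                             (Eq.trans eq (Eq.sym (fst-deMorgan o α β)))))
      where open Equivalence (↔ᶠ-designated⇔ (¬ᶠ (bin o α β)) (deMorgan o α β))

  -- Equality on El need not be decidable, so the choices of values are
  -- prescribed at the formulas un o p and bin o p q, not at z and (z , w).
  module _ {z w : El}
           (un-choice  : ∀ o → Satisfiable (unᴹ o z))
           (bin-choice : ∀ o → Satisfiable (binᴹ o z w)) where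

    p q : For
    p = var 0
    q = var 1

    -- Defined mutually with its witnesses: the value of a compound formula is the first component
    -- of a witness that the multioperation is nonempty at the values of its parts, and the second
    -- component gives validity.
    v : For → El
    un-value  : ∀ o α → Satisfiable (unᴹ o (v α))
    bin-value : ∀ o α β → Satisfiable (binᴹ o (v α) (v β))

    v (var zero)    = z
    v (var (suc _)) = w
    v (un o α)      = proj₁ (un-value o α)
    v (bin o α β)   = proj₁ (bin-value o α β)

    -- The prescribed choice is used only at `p`; every other formula takes the default witness of
    -- nonemptiness.
    un-value o (var zero) = un-choice o
    un-value o α          = un-nonempty o (v α)

    -- All variables other than `p` have value `w`, so the prescribed choice has the right type for
    -- each of them, `q` included.
    bin-value o (var zero) (var (suc _)) = bin-choice o
    bin-value o α          β             = bin-nonempty o (v α) (v β)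

    v-valid : IsValuation M v
    v-valid = (λ o α → proj₂ (un-value o α)) , (λ o α β → proj₂ (bin-value o α β))

    ¬¬-valid⇒un-choice : Validates M ¬¬-schema → fst z ≤ snd (proj₁ (un-choice neg))
    ¬¬-valid⇒un-choice ax =
      Equivalence.to (¬¬-designated⇔ v-valid p q) (ax _ (p , q , refl) v v-valid)

    deMorgan-valid⇒bin-choice : ∀ o → Validates M (deMorgan-schema o) →
                                snd (proj₁ (bin-choice o)) ≈ binᴸ₂ o z w
    deMorgan-valid⇒bin-choice o ax =
      Equivalence.to (deMorgan-designated⇔ v-valid o p q) (ax _ (p , q , refl) v v-valid)

  ¬¬-valid⇔ : Validates M ¬¬-schema ⇔ (∀ z u → u ∈ unᴹ neg z → fst z ≤ snd u)
  ¬¬-valid⇔ = mk⇔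
    -- The given `u` becomes the value of `¬ᶠ p`; `z` is the default value for the variables other
    -- than `p`.
    (λ ax z u u∈ → ¬¬-valid⇒un-choice {w = z}
       (λ { neg → u , u∈ ; circ → un-nonempty circ z }) (λ o → bin-nonempty o z z) ax)
    (λ { h _ (α , β , refl) v valid →
         Equivalence.from (¬¬-designated⇔ valid α β)
           (h (v α) (v (¬ᶠ α)) (proj₁ valid neg α)) })

  deMorgan-valid⇔ : ∀ o → Validates M (deMorgan-schema o) ⇔
                    (∀ z w u → u ∈ binᴹ o z w → snd u ≈ binᴸ₂ o z w)
  deMorgan-valid⇔ o = mk⇔ (snd-determined o)
    (λ { h _ (α , β , refl) v valid →
         Equivalence.from (deMorgan-designated⇔ valid o α β)
           (h (v α) (v β) (v (bin o α β)) (proj₂ valid o α β)) })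
    where
    choose : ∀ o {z w u} → u ∈ binᴹ o z w → ∀ o′ → Satisfiable (binᴹ o′ z w)
    choose and u∈ and = _ , u∈
    choose or  u∈ or  = _ , u∈
    choose imp u∈ imp = _ , u∈
    choose _   _  o′  = bin-nonempty o′ _ _

    snd-determined : ∀ o → Validates M (deMorgan-schema o) →
                     ∀ z w u → u ∈ binᴹ o z w → snd u ≈ binᴸ₂ o z w
    -- The split on the connective lets `choose` compute, so that the value of `bin o p q` reduces
    -- to `u`.
    snd-determined and ax z w u u∈ =
      deMorgan-valid⇒bin-choice (λ o′ → un-nonempty o′ z) (choose and u∈) and ax
    snd-determined or ax z w u u∈ =
      deMorgan-valid⇒bin-choice (λ o′ → un-nonempty o′ z) (choose or u∈) or ax
    snd-determined imp ax z w u u∈ =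
      deMorgan-valid⇒bin-choice (λ o′ → un-nonempty o′ z) (choose imp u∈) imp ax

  singleton : ∀ {a} {P : Pred El m} → Satisfiable P →
              (∀ u → u ∈ P → _≋_ 𝒜 (proj₁ u) a) → Is｛_｝ 𝒜 a P
  singleton (u , u∈) h = (u , u∈ , h u u∈) , h

  fst-binᴸ : ∀ o z w → proj₁ (binᴸ 𝒜 o (proj₁ z) (proj₁ w)) ≈ ⟦_⟧ 𝒜 o (fst z) (fst w)
  fst-binᴸ and z w = Eq.refl
  fst-binᴸ or  z w = Eq.refl
  fst-binᴸ imp z w = Eq.refl

  LFI1∘⇒Ax : 𝕂-LFI1∘ (𝒜 , ℬ) → All (Validates M) Ax
  LFI1∘⇒Ax (un-eq , bin-eq) = ¬¬ ∷ dm or ∷ dm and ∷ dm imp ∷ []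
    where
    ¬¬ : Validates M ¬¬-schema
    ¬¬ = Equivalence.from ¬¬-valid⇔
      (λ z u u∈ → reflexive (Eq.sym (proj₂ (proj₂ (un-eq neg z) u u∈))))
    dm : ∀ o → Validates M (deMorgan-schema o)
    dm o = Equivalence.from (deMorgan-valid⇔ o)
      (λ z w u u∈ → proj₂ (proj₂ (bin-eq o z w) u u∈))

  Ax⇒LFI1∘ : All (Validates M) Ax → 𝕂-LFI1∘ (𝒜 , ℬ)
  Ax⇒LFI1∘ (¬¬ ∷ dm-or ∷ dm-and ∷ dm-imp ∷ []) = un-eq , bin-eq
    where
    un-eq : ∀ o z → Is｛_｝ 𝒜 (unᴸ 𝒜 o (proj₁ z)) (unᴹ o z)
    un-eq neg z = singleton (un-nonempty neg z) λ u u∈ →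
      -- Every swap structure for Ci gives `snd u ≤ fst z`; the double negation axiom supplies the
      -- converse inequality.
      proj₁ (neg-sub z u∈) ,
      antisym (proj₂ (neg-sub z u∈)) (Equivalence.to ¬¬-valid⇔ ¬¬ z u u∈)
    -- Ci and LFI1∘ prescribe the same value for the consistency operator.
    un-eq circ z = circ-eq z

    dm : ∀ o → Validates M (deMorgan-schema o)
    dm and = dm-and
    dm or  = dm-or
    dm imp = dm-imp

    bin-eq : ∀ o z w → Is｛_｝ 𝒜 (binᴸ 𝒜 o (proj₁ z) (proj₁ w)) (binᴹ o z w)
    bin-eq o z w = singleton (bin-nonempty o z w) λ u u∈ →
      Eq.trans (bin-sub o z w u∈) (Eq.sym (fst-binᴸ o z w)) ,
      Equivalence.to (deMorgan-valid⇔ o) (dm o) z w u u∈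

proposition9p5 : {c ℓ₁ ℓ₂ b m : Level} →
    𝕂-LFI1∘ {c} {ℓ₁} {ℓ₂} {b} {m} ≐ (λ ℬ → All (Validates (ℳ ℬ)) Ax)
proposition9p5 = (λ { {𝒜 , ℬ} → LFI1∘⇒Ax 𝒜 ℬ }) , (λ { {𝒜 , ℬ} → Ax⇒LFI1∘ 𝒜 ℬ })
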